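{- Let $R, R_1,\dots,R_r$ ($r \ge 1$) be finite commutative rings with $1\neq 0$, each $R_i$ local, such that $R \cong R_1\times\cdots\times R_r$. Then $$\Gamma(R) \;\cong\; \Gamma(R_1)\times_\Gamma \cdots \times_\Gamma \Gamma(R_r)$$ as graphs (with loops).
   Context: All graphs are undirected, may have loops, and have no multiple edges. For a finite commutative ring $R$ with $1\ne 0$, let $Z^*(R)$ be the set of non-zero zero-divisors of $R$ and $U(R)$ its set of units. The zero-divisor graph $\Gamma(R)$ has vertex set $Z^*(R)$, and two (not necessarily distinct) vertices $x,y$ are adjacent iff $xy=0$; so there is a loop at $x$ iff $x^2=0$. Graph operations. The direct product $G_1\times G_2$ has vertex set $V(G_1)\times V(G_2)$, with $(v_1,v_2)$ adjacent to $(v_1',v_2')$ iff $v_1$ is adjacent to $v_1'$ in $G_1$ and $v_2$ is adjacent to $v_2'$ in $G_2$. The complete product $G_1\nabla G_2$ has vertex set the disjoint union $V(G_1)\cup V(G_2)$; its edges are those of $G_1$, those of $G_2$, and all edges between a vertex of $G_1$ and a vertex of $G_2$. If $v$ is a vertex of both $G_1$ and $G_2$, then $G_1\overset{v}{\bullet}G_2$ is the graph obtained from the disjoint union of $G_1$ and $G_2$ by identifying the two copies of $v$. For $S \subseteq V(G)$, $G\setminus S$ is the graph obtained by deleting the vertices in $S$ and all edges incident to them. Let $\mathrm U(R)$, as a graph, be the graph with vertex set $U(R)$ and no edges (the unit graph); let $\mathrm Z(R)$ be the graph with the single vertex $0\in R$ and no edges, and $\mathrm{Z_L}(R)$ the graph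 with the single vertex $0\in R$ and a loop at it. The extended zero-divisor graph is $$\mathrm{E}\Gamma(R) = \big(\Gamma(R)\nabla \mathrm Z(R)\big)\overset{0}{\bullet}\big(\mathrm U(R)\nabla \mathrm{Z_L}(R)\big),$$ which has vertex set $R$. For finite commutative rings $R_1,R_2$ with $1\neq 0$, define $$\Gamma(R_1)\times_\Gamma\Gamma(R_2) := \big(\mathrm{E}\Gamma(R_1)\times \mathrm{E}\Gamma(R_2)\big)\setminus\big(\{(0,0)\}\cup U(R_1\times R_2)\big).$$ The product is associative, and the $r$-fold product $\Gamma(R_1)\times_\Gamma\cdots\times_\Gamma\Gamma(R_r)$ is the graph $\mathrm{E}\Gamma(R_1)\times\cdots\times \mathrm{E}\Gamma(R_r)$ with the vertex $(0,\dots,0)$ and all vertices $(u_1,\dots,u_r)$ with $u_i\in U(R_i)$ for all $i$ deleted. -}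

module Defs where

open import Algebra.Bundles using (CommutativeRing)
import Algebra.Definitions as AlgDefs
open import Algebra.Morphism.Structures using (module RingMorphisms)
open import Data.Empty.Polymorphic using (⊥)
open import Data.Fin.Base using (Fin)
open import Data.Nat.Base using (ℕ)
open import Data.Product.Base using (Σ; Σ-syntax; ∃-syntax; _×_; _,_; proj₁; proj₂)
open import Data.Sum.Base using (_⊎_; inj₁; inj₂; [_,_])
open import Data.Sum.Relation.Binary.Pointwise as Sum using (Pointwise; _⊎ₛ_)
open import Data.Unit.Polymorphic using (⊤; tt)
open import Function.Bundles using (Inverse; _⇔_)
open import Level using (Level; _⊔_) renaming (suc to lsuc)
open import Relation.Binary.Bundles using (Setoid)
open import Relation.Binary.Core using (Rel)
open import Relation.Binary.Definitions using (Symmetric; _Respects₂_)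
import Relation.Binary.Construct.On as On
open import Relation.Binary.PropositionalEquality.Properties as ≡ using ()
open import Relation.Nullary.Negation.Core using (¬_)
open import Relation.Unary using (Pred; _∈_; _∉_; _⊆_; _≐_)

------------------------------------------------------------------------
-- Rings

module _ {c ℓ : Level} (R : CommutativeRing c ℓ) where
  open CommutativeRing R

  IsFinite : Set (c ⊔ ℓ)
  IsFinite = ∃[ n ] Inverse setoid (≡.setoid (Fin n))

  IsNontrivial : Set ℓ
  IsNontrivial = 1# ≉ 0#

  IsUnit : Pred Carrier (c ⊔ ℓ)
  IsUnit = AlgDefs.Invertible _≈_ 1# _*_

  IsNonzeroZeroDivisor : Pred Carrier (c ⊔ ℓ)
  IsNonzeroZeroDivisor x = x ≉ 0# × (∃[ y ] y ≉ 0# × x * y ≈ 0#)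

  -- Closure under negation follows from closure under multiples.
  record IsIdeal {p : Level} (I : Pred Carrier p) : Set (c ⊔ ℓ ⊔ p) where
    field
      resp     : ∀ {x y} → x ≈ y → x ∈ I → y ∈ I
      0∈       : 0# ∈ I
      +-closed : ∀ {x y} → x ∈ I → y ∈ I → x + y ∈ I
      *-closed : ∀ a {x} → x ∈ I → a * x ∈ I

  -- Maximal among the proper ideals.  Subsets of the carrier are taken
  -- at level c ⊔ ℓ, which contains principal ideals and the set of
  -- nonunits.
  record IsMaximalIdeal (M : Pred Carrier (c ⊔ ℓ)) : Set (lsuc (c ⊔ ℓ)) where
    field
      isIdeal : IsIdeal M
      proper  : 1# ∉ M
      maximal : (J : Pred Carrier (c ⊔ ℓ)) → IsIdeal J → 1# ∉ J →
                M ⊆ J → J ⊆ M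

  IsLocal : Set (lsuc (c ⊔ ℓ))
  IsLocal = Σ[ M ∈ Pred Carrier (c ⊔ ℓ) ]
              IsMaximalIdeal M ×
              ((N : Pred Carrier (c ⊔ ℓ)) → IsMaximalIdeal N → N ≐ M)

  subset : {p : Level} → Pred Carrier p → Setoid (c ⊔ p) ℓ
  subset P = On.setoid setoid (proj₁ {B = P})

infix 4 _≅ᴿ_

_≅ᴿ_ : {c₁ ℓ₁ c₂ ℓ₂ : Level} →
       CommutativeRing c₁ ℓ₁ → CommutativeRing c₂ ℓ₂ → Set (c₁ ⊔ ℓ₁ ⊔ c₂ ⊔ ℓ₂)
R ≅ᴿ S = Σ[ f ∈ (R.Carrier → S.Carrier) ]
           RingMorphisms.IsRingIsomorphism R.rawRing S.rawRing f
  where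
  module R = CommutativeRing R
  module S = CommutativeRing S

∏ᴿ : {c ℓ : Level} {r : ℕ} → (Fin r → CommutativeRing c ℓ) → CommutativeRing c ℓ
∏ᴿ {r = r} R = record
  { Carrier = (i : Fin r) → R.Carrier i
  ; _≈_     = λ x y → ∀ i → R._≈_ i (x i) (y i)
  ; _+_     = λ x y i → R._+_ i (x i) (y i)
  ; _*_     = λ x y i → R._*_ i (x i) (y i)
  ; -_      = λ x i → R.-_ i (x i)
  ; 0#      = λ i → R.0# i
  ; 1#      = λ i → R.1# i
  ; isCommutativeRing = record
    { isRing = record
      { +-isAbelianGroup = record
        { isGroup = record
          { isMonoid = record
            { isSemigroup = record
              { isMagma = record
                { isEquivalence = record
                  { refl  = λ i → R.refl i
                  ; sym   = λ p i → R.sym i (p i)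
                  ; trans = λ p q i → R.trans i (p i) (q i)
                  }
                ; ∙-cong = λ p q i → R.+-cong i (p i) (q i)
                }
              ; assoc = λ x y z i → R.+-assoc i (x i) (y i) (z i)
              }
            ; identity = (λ x i → R.+-identityˡ i (x i))
                       , (λ x i → R.+-identityʳ i (x i))
            }
          ; inverse = (λ x i → R.-‿inverseˡ i (x i))
                    , (λ x i → R.-‿inverseʳ i (x i))
          ; ⁻¹-cong = λ p i → R.-‿cong i (p i)
          }
        ; comm = λ x y i → R.+-comm i (x i) (y i)
        }
      ; *-cong     = λ p q i → R.*-cong i (p i) (q i)
      ; *-assoc    = λ x y z i → R.*-assoc i (x i) (y i) (z i)
      ; *-identity = (λ x i → R.*-identityˡ i (x i))
                   , (λ x i → R.*-identityʳ i (x i))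
      ; distrib    = (λ x y z i → R.distribˡ i (x i) (y i) (z i))
                   , (λ x y z i → R.distribʳ i (x i) (y i) (z i))
      }
    ; *-comm = λ x y i → R.*-comm i (x i) (y i)
    }
  }
  where module R (i : Fin r) = CommutativeRing (R i)

------------------------------------------------------------------------
-- Graphs: undirected, loops allowed, no multiple edges (a vertex pair is
-- or is not adjacent; proofs of adjacency are never counted).

record Graph (v e a : Level) : Set (lsuc (v ⊔ e ⊔ a)) where
  field
    vertices : Setoid v e
  open Setoid vertices public using (_≈_) renaming (Carrier to V)
  field
    Adj      : Rel V a
    Adj-sym  : Symmetric Adj
    Adj-resp : Adj Respects₂ _≈_

open Graph using (V; vertices)

infix 4 _≅ᴳ_

record _≅ᴳ_ {v₁ e₁ a₁ v₂ e₂ a₂ : Level}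
            (G : Graph v₁ e₁ a₁) (H : Graph v₂ e₂ a₂)
            : Set (v₁ ⊔ e₁ ⊔ a₁ ⊔ v₂ ⊔ e₂ ⊔ a₂) where
  private
    module G = Graph G
    module H = Graph H
  field
    bijection : Inverse G.vertices H.vertices
  open Inverse bijection public using (to; from)
  field
    adjacency : ∀ x y → G.Adj x y ⇔ H.Adj (to x) (to y)

∏ᴳ : {v e a : Level} {r : ℕ} → (Fin r → Graph v e a) → Graph v e a
∏ᴳ {r = r} G = record
  { vertices = record
    { Carrier       = (i : Fin r) → G.V i
    ; _≈_           = λ x y → ∀ i → G._≈_ i (x i) (y i)
    ; isEquivalence = record
      { refl  = λ i → Setoid.refl (G.vertices i)
      ; sym   = λ p i → Setoid.sym (G.vertices i) (p i)
      ; trans = λ p q i → Setoid.trans (G.vertices i) (p i) (q i)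
      }
    }
  ; Adj      = λ x y → ∀ i → G.Adj i (x i) (y i)
  ; Adj-sym  = λ p i → G.Adj-sym i (p i)
  ; Adj-resp = (λ p q i → proj₁ (G.Adj-resp i) (p i) (q i))
             , (λ p q i → proj₂ (G.Adj-resp i) (p i) (q i))
  }
  where module G (i : Fin r) = Graph (G i)

infixl 7 _∖_

_∖_ : {v e a p : Level} (G : Graph v e a) → Pred (V G) p → Graph (v ⊔ p) e a
G ∖ S = record
  { vertices = On.setoid G.vertices (proj₁ {B = λ x → x ∉ S})
  ; Adj      = λ x y → G.Adj (proj₁ x) (proj₁ y)
  ; Adj-sym  = G.Adj-sym
  ; Adj-resp = proj₁ G.Adj-resp , proj₂ G.Adj-resp
  }
  where module G = Graph G

module _ {v₁ e₁ a₁ v₂ e₂ a₂ : Level}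
         (G₁ : Graph v₁ e₁ a₁) (G₂ : Graph v₂ e₂ a₂) where
  private
    module G₁ = Graph G₁
    module G₂ = Graph G₂

  data ∇-Adj : Rel (G₁.V ⊎ G₂.V) (v₁ ⊔ v₂ ⊔ a₁ ⊔ a₂) where
    left   : ∀ {x y} → G₁.Adj x y → ∇-Adj (inj₁ x) (inj₁ y)
    right  : ∀ {x y} → G₂.Adj x y → ∇-Adj (inj₂ x) (inj₂ y)
    cross  : ∀ {x y} → ∇-Adj (inj₁ x) (inj₂ y)
    cross′ : ∀ {x y} → ∇-Adj (inj₂ x) (inj₁ y)

  infixl 6 _∇_

  _∇_ : Graph (v₁ ⊔ v₂) (v₁ ⊔ v₂ ⊔ e₁ ⊔ e₂) (v₁ ⊔ v₂ ⊔ a₁ ⊔ a₂)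
  _∇_ = record
    { vertices = G₁.vertices ⊎ₛ G₂.vertices
    ; Adj      = ∇-Adj
    ; Adj-sym  = λ where
        (left p)  → left (G₁.Adj-sym p)
        (right p) → right (G₂.Adj-sym p)
        cross     → cross′
        cross′    → cross
    ; Adj-resp = respʳ , respˡ
    }
    where
    _≈′_ : Rel (G₁.V ⊎ G₂.V) (v₁ ⊔ v₂ ⊔ e₁ ⊔ e₂)
    _≈′_ = Pointwise G₁._≈_ G₂._≈_

    respʳ : ∀ {x y z} → y ≈′ z → ∇-Adj x y → ∇-Adj x z
    respʳ (Sum.inj₁ q) (left p)  = left (proj₁ G₁.Adj-resp q p)
    respʳ (Sum.inj₂ q) (right p) = right (proj₁ G₂.Adj-resp q p)
    respʳ (Sum.inj₂ q) cross     = cross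
    respʳ (Sum.inj₁ q) cross′    = cross′

    respˡ : ∀ {x y z} → y ≈′ z → ∇-Adj y x → ∇-Adj z x
    respˡ (Sum.inj₁ q) (left p)  = left (proj₂ G₁.Adj-resp q p)
    respˡ (Sum.inj₂ q) (right p) = right (proj₂ G₂.Adj-resp q p)
    respˡ (Sum.inj₁ q) cross     = cross
    respˡ (Sum.inj₂ q) cross′    = cross′

  -- The least equivalence on the disjoint union that contains both
  -- equalities and identifies p with q.
  data Glue (p : G₁.V) (q : G₂.V)
            : Rel (G₁.V ⊎ G₂.V) (v₁ ⊔ v₂ ⊔ e₁ ⊔ e₂) where
    left   : ∀ {x y} → x G₁.≈ y → Glue p q (inj₁ x) (inj₁ y)
    right  : ∀ {x y} → x G₂.≈ y → Glue p q (inj₂ x) (inj₂ y)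
    cross  : ∀ {x y} → x G₁.≈ p → y G₂.≈ q → Glue p q (inj₁ x) (inj₂ y)
    cross′ : ∀ {x y} → x G₂.≈ q → y G₁.≈ p → Glue p q (inj₂ x) (inj₁ y)

  -- Two glued vertices are adjacent when some representatives of them are
  -- adjacent in the disjoint union.
  coalesce : G₁.V → G₂.V →
             Graph (v₁ ⊔ v₂) (v₁ ⊔ v₂ ⊔ e₁ ⊔ e₂)
                   (v₁ ⊔ v₂ ⊔ e₁ ⊔ e₂ ⊔ a₁ ⊔ a₂)
  coalesce p q = record
    { vertices = record
      { Carrier       = G₁.V ⊎ G₂.V
      ; _≈_           = _~_
      ; isEquivalence = record { refl = ~-refl ; sym = ~-sym ; trans = ~-trans }
      }
    ; Adj      = λ x y → ∃[ x′ ] ∃[ y′ ]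
                   x ~ x′ × y ~ y′ × Pointwise G₁.Adj G₂.Adj x′ y′
    ; Adj-sym  = λ (x′ , y′ , xx′ , yy′ , e) →
                   y′ , x′ , yy′ , xx′ , Sum.⊎-symmetric G₁.Adj-sym G₂.Adj-sym e
    ; Adj-resp = (λ yz (x′ , y′ , xx′ , yy′ , e) →
                    x′ , y′ , xx′ , ~-trans (~-sym yz) yy′ , e)
               , (λ yz (y′ , x′ , yy′ , xx′ , e) →
                    y′ , x′ , ~-trans (~-sym yz) yy′ , xx′ , e)
    }
    where
    module S₁ = Setoid G₁.vertices
    module S₂ = Setoid G₂.vertices

    _~_ : Rel (G₁.V ⊎ G₂.V) (v₁ ⊔ v₂ ⊔ e₁ ⊔ e₂)
    _~_ = Glue p q

    ~-refl : ∀ {x} → x ~ x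
    ~-refl {inj₁ _} = left S₁.refl
    ~-refl {inj₂ _} = right S₂.refl

    ~-sym : ∀ {x y} → x ~ y → y ~ x
    ~-sym (left s)     = left (S₁.sym s)
    ~-sym (right s)    = right (S₂.sym s)
    ~-sym (cross s t)  = cross′ t s
    ~-sym (cross′ s t) = cross t s

    ~-trans : ∀ {x y z} → x ~ y → y ~ z → x ~ z
    ~-trans (left s)     (left t)      = left (S₁.trans s t)
    ~-trans (left s)     (cross t u)   = cross (S₁.trans s t) u
    ~-trans (right s)    (right t)     = right (S₂.trans s t)
    ~-trans (right s)    (cross′ t u)  = cross′ (S₂.trans s t) u
    ~-trans (cross s t)  (right u)     = cross s (S₂.trans (S₂.sym u) t)
    ~-trans (cross s t)  (cross′ u w)  = left (S₁.trans s (S₁.sym w))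
    ~-trans (cross′ s t) (left u)      = cross′ s (S₁.trans (S₁.sym u) t)
    ~-trans (cross′ s t) (cross u w)   = right (S₂.trans s (S₂.sym w))

------------------------------------------------------------------------
-- Zero-divisor graphs

module _ {c ℓ : Level} (R : CommutativeRing c ℓ) where
  open CommutativeRing R

  Γ : Graph (c ⊔ ℓ) ℓ ℓ
  Γ = record
    { vertices = subset R (IsNonzeroZeroDivisor R)
    ; Adj      = λ x y → proj₁ x * proj₁ y ≈ 0#
    ; Adj-sym  = λ xy≈0 → trans (*-comm _ _) xy≈0
    ; Adj-resp = (λ y≈z xy≈0 → trans (*-congˡ (sym y≈z)) xy≈0)
               , (λ y≈z yx≈0 → trans (*-congʳ (sym y≈z)) yx≈0)
    }

  edgeless : {p : Level} → Pred Carrier p → Graph (c ⊔ p) ℓ ℓ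
  edgeless P = record
    { vertices = subset R P
    ; Adj      = λ _ _ → ⊥
    ; Adj-sym  = λ ()
    ; Adj-resp = (λ _ ()) , (λ _ ())
    }

  IsZero : Pred Carrier ℓ
  IsZero x = x ≈ 0#

  U Z Z-L : Graph (c ⊔ ℓ) ℓ ℓ
  U   = edgeless (IsUnit R)
  Z   = edgeless IsZero
  Z-L = record
    { vertices = subset R IsZero
    ; Adj      = λ _ _ → ⊤
    ; Adj-sym  = λ _ → tt
    ; Adj-resp = (λ _ _ → tt) , (λ _ _ → tt)
    }

  EΓ : Graph (c ⊔ ℓ) (c ⊔ ℓ) (c ⊔ ℓ)
  EΓ = coalesce (Γ ∇ Z) (U ∇ Z-L) (inj₂ (0# , refl)) (inj₂ (0# , refl))

  -- The element of R that a vertex of EΓ is: every vertex of the four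
  -- constituent graphs is an element of R with a proof of membership.
  element : V EΓ → Carrier
  element = [ [ proj₁ , proj₁ ] , [ proj₁ , proj₁ ] ]

-- The r-fold product  Γ(R₁) ×_Γ ⋯ ×_Γ Γ(R_r).
∏Γ : {c ℓ : Level} {r : ℕ} → (Fin r → CommutativeRing c ℓ) →
     Graph (c ⊔ ℓ) (c ⊔ ℓ) (c ⊔ ℓ)
∏Γ R = ∏ᴳ (λ i → EΓ (R i)) ∖ λ v →
         (∀ i → IsZero (R i) (element (R i) (v i))) ⊎
         (∀ i → IsUnit (R i) (element (R i) (v i)))

{-# OPTIONS --safe #-}

-- Two elements of EΓ(S) are adjacent iff their product is 0, and every element
-- of a finite ring is zero, a nonzero zero-divisor or a unit, so EΓ(S) is the
-- annihilation graph on all of S.  Multiplication in a product ring is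
-- componentwise, so annihilation in R ≅ ∏ Rᵢ is adjacency in the direct product
-- of the EΓ(Rᵢ); the deleted vertices are exactly 0 and the units of ∏ Rᵢ.

module Submission where

open import Defs
open import Algebra.Bundles using (CommutativeRing)
open import Algebra.Morphism.Structures using (module RingMorphisms)
import Algebra.Properties.Ring as RingProperties
open import Data.Fin.Base using (Fin; zero; suc; _<_)
open import Data.Fin.Properties as Fin using (pigeonhole; <⇒≢)
open import Data.Nat.Base using (ℕ; _≥_)
open import Data.Nat.Properties using (n<1+n)
open import Data.Product.Base using (∃-syntax; _×_; _,_; proj₁; proj₂)
open import Data.Sum.Base using (_⊎_; inj₁; inj₂; [_,_])
open import Data.Sum.Relation.Binary.Pointwise as Sum using ()
open import Data.Unit.Polymorphic using (tt)
open import Function.Base using (_∘_)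
open import Function.Bundles using (Inverse; mk⇔)
open import Function.Properties.Inverse using (Inverse⇒Injection)
open import Level using (Level)
open import Relation.Binary.Definitions using (Decidable)
open import Relation.Binary.PropositionalEquality.Core as ≡ using (_≡_)
open import Relation.Nullary.Decidable.Core using (yes; no)
open import Relation.Nullary.Decidable using (via-injection)
open import Relation.Nullary.Negation.Core using (¬_; contradiction)

private
  variable
    c ℓ : Level

-- Units and zero divisors of a finite ring.

module _ (R : CommutativeRing c ℓ) where
  open CommutativeRing R
  open RingProperties ring using (x[y-z]≈xy-xz; x∙y⁻¹≈ε⇒x≈y; x≈y⇒x∙y⁻¹≈ε)

  finite⇒≈-decidable : IsFinite R → Decidable _≈_
  finite⇒≈-decidable (_ , index) = via-injection (Inverse⇒Injection index) Fin._≟_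

  -- With n elements e₀, …, eₙ₋₁, two of the n + 1 elements 1, x e₀, …, x eₙ₋₁
  -- coincide: either 1 ≈ x eⱼ, or x (eᵢ - eⱼ) ≈ 0 with i ≠ j.
  annihilator⊎unit : IsFinite R → ∀ x → (∃[ y ] y ≉ 0# × x * y ≈ 0#) ⊎ IsUnit R x
  annihilator⊎unit (n , index) x = collision (pigeonhole (n<1+n n) (to ∘ g))
    where
    open Inverse index using (to; from; inverse; strictlyInverseˡ)

    g : Fin (ℕ.suc n) → Carrier
    g zero    = 1#
    g (suc i) = x * from i

    to-injective : ∀ {a b} → to a ≡ to b → a ≈ b
    to-injective p = trans (sym (proj₂ inverse (≡.sym p))) (proj₂ inverse ≡.refl)

    from-injective : ∀ {i j} → from i ≈ from j → i ≡ j
    from-injective {i} p = ≡.trans (≡.sym (strictlyInverseˡ i)) (proj₁ inverse p)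

    collision : (∃[ i ] ∃[ j ] i < j × to (g i) ≡ to (g j)) →
                (∃[ y ] y ≉ 0# × x * y ≈ 0#) ⊎ IsUnit R x
    collision (zero , suc j , _ , p) =
      inj₂ (from j , trans (*-comm _ _) x*eⱼ≈1 , x*eⱼ≈1)
      where x*eⱼ≈1 = sym (to-injective p)
    collision (suc i , suc j , i<j , p) = inj₁
      ( from i - from j
      , (λ q → <⇒≢ i<j (≡.cong suc (from-injective (x∙y⁻¹≈ε⇒x≈y _ _ q))))
      , trans (x[y-z]≈xy-xz x _ _) (x≈y⇒x∙y⁻¹≈ε (to-injective p))
      )

  unit-cancel : ∀ {x y} → IsUnit R x → x * y ≈ 0# → y ≈ 0#
  unit-cancel {x} {y} (z , zx≈1 , _) xy≈0 = begin
    y            ≈⟨ *-identityˡ y ⟨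
    1# * y       ≈⟨ *-congʳ zx≈1 ⟨
    z * x * y    ≈⟨ *-assoc z x y ⟩
    z * (x * y)  ≈⟨ *-congˡ xy≈0 ⟩
    z * 0#       ≈⟨ zeroʳ z ⟩
    0#           ∎
    where open import Relation.Binary.Reasoning.Setoid setoid

  zeroDivisor⇒¬unit : ∀ {x} → IsNonzeroZeroDivisor R x → ¬ IsUnit R x
  zeroDivisor⇒¬unit (_ , _ , y≉0 , xy≈0) ux = y≉0 (unit-cancel ux xy≈0)

  unit-resp : ∀ {x y} → x ≈ y → IsUnit R x → IsUnit R y
  unit-resp x≈y (z , zx≈1 , xz≈1) =
    z , trans (*-congˡ (sym x≈y)) zx≈1 , trans (*-congʳ (sym x≈y)) xz≈1

  unit≉zeroDivisor : ∀ {x y} → IsUnit R x → IsNonzeroZeroDivisor R y → x ≉ y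
  unit≉zeroDivisor ux zy x≈y = zeroDivisor⇒¬unit zy (unit-resp x≈y ux)

  ¬0-¬unit⇒zeroDivisor : IsFinite R → ∀ {x} → x ≉ 0# → ¬ IsUnit R x →
                         IsNonzeroZeroDivisor R x
  ¬0-¬unit⇒zeroDivisor fin {x} x≉0 ¬ux with annihilator⊎unit fin x
  ... | inj₁ ann = x≉0 , ann
  ... | inj₂ ux  = contradiction ux ¬ux

  -- The extended zero-divisor graph as the annihilation graph.

  module EΓ = Graph (EΓ R)

  -- Gluing identifies only the two copies of 0, so in the crossing cases both elements are 0.
  element-cong : ∀ {v w} → v EΓ.≈ w → element R v ≈ element R w
  element-cong (left (Sum.inj₁ p))              = p
  element-cong (left (Sum.inj₂ p))              = p
  element-cong (right (Sum.inj₁ p))             = p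
  element-cong (right (Sum.inj₂ p))             = p
  element-cong (cross (Sum.inj₂ p) (Sum.inj₂ q))  = trans p (sym q)
  element-cong (cross′ (Sum.inj₂ p) (Sum.inj₂ q)) = trans p (sym q)

  -- Finiteness decides `x ≈ 0#` and otherwise yields an annihilator or an inverse, which selects
  -- the constituent graph. For 0 the copy in `Z` is taken; the copy in `Z-L` is glued to it.
  vertexOver : IsFinite R → ∀ x → ∃[ v ] element R v ≡ x
  vertexOver fin x with finite⇒≈-decidable fin x 0#
  ... | yes x≈0 = inj₁ (inj₂ (x , x≈0)) , ≡.refl
  ... | no  x≉0 with annihilator⊎unit fin x
  ...   | inj₁ ann = inj₁ (inj₁ (x , x≉0 , ann)) , ≡.refl
  ...   | inj₂ ux  = inj₂ (inj₁ (x , ux)) , ≡.refl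

  module _ (1≉0 : IsNontrivial R) where

    unit⇒≉0 : ∀ {x} → IsUnit R x → x ≉ 0#
    unit⇒≉0 {x} (y , yx≈1 , _) x≈0 =
      1≉0 (trans (sym yx≈1) (trans (*-congˡ x≈0) (zeroʳ y)))

    -- Zero, the nonzero zero-divisors and the units are pairwise disjoint (`1≉0` keeps 0 apart from
    -- the units), so the only coincidence between different constituents is that of the two zeros,
    -- which the gluing supplies.
    element-injective : ∀ v w → element R v ≈ element R w → v EΓ.≈ w
    element-injective (inj₁ (inj₁ _)) (inj₁ (inj₁ _)) p = left (Sum.inj₁ p)
    element-injective (inj₁ (inj₁ (_ , zx))) (inj₁ (inj₂ (_ , y≈0))) p =
      contradiction (trans p y≈0) (proj₁ zx)
    element-injective (inj₁ (inj₁ (_ , zx))) (inj₂ (inj₁ (_ , uy))) p =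
      contradiction (sym p) (unit≉zeroDivisor uy zx)
    element-injective (inj₁ (inj₁ (_ , zx))) (inj₂ (inj₂ (_ , y≈0))) p =
      contradiction (trans p y≈0) (proj₁ zx)
    element-injective (inj₁ (inj₂ (_ , x≈0))) (inj₁ (inj₁ (_ , zy))) p =
      contradiction (trans (sym p) x≈0) (proj₁ zy)
    element-injective (inj₁ (inj₂ _)) (inj₁ (inj₂ _)) p = left (Sum.inj₂ p)
    element-injective (inj₁ (inj₂ (_ , x≈0))) (inj₂ (inj₁ (_ , uy))) p =
      contradiction (trans (sym p) x≈0) (unit⇒≉0 uy)
    element-injective (inj₁ (inj₂ (_ , x≈0))) (inj₂ (inj₂ (_ , y≈0))) p =
      cross (Sum.inj₂ x≈0) (Sum.inj₂ y≈0)
    element-injective (inj₂ (inj₁ (_ , ux))) (inj₁ (inj₁ (_ , zy))) p =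
      contradiction p (unit≉zeroDivisor ux zy)
    element-injective (inj₂ (inj₁ (_ , ux))) (inj₁ (inj₂ (_ , y≈0))) p =
      contradiction (trans p y≈0) (unit⇒≉0 ux)
    element-injective (inj₂ (inj₁ _)) (inj₂ (inj₁ _)) p = right (Sum.inj₁ p)
    element-injective (inj₂ (inj₁ (_ , ux))) (inj₂ (inj₂ (_ , y≈0))) p =
      contradiction (trans p y≈0) (unit⇒≉0 ux)
    element-injective (inj₂ (inj₂ (_ , x≈0))) (inj₁ (inj₁ (_ , zy))) p =
      contradiction (trans (sym p) x≈0) (proj₁ zy)
    element-injective (inj₂ (inj₂ (_ , x≈0))) (inj₁ (inj₂ (_ , y≈0))) p =
      cross′ (Sum.inj₂ x≈0) (Sum.inj₂ y≈0)
    element-injective (inj₂ (inj₂ (_ , x≈0))) (inj₂ (inj₁ (_ , uy))) p =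
      contradiction (trans (sym p) x≈0) (unit⇒≉0 uy)
    element-injective (inj₂ (inj₂ _)) (inj₂ (inj₂ _)) p = right (Sum.inj₂ p)

    -- Adjacency passes to representatives with the same elements. An edge there lies inside `Γ`,
    -- where it is annihilation by definition, or has a copy of 0 as an endpoint.
    EΓ-adj⇒*≈0 : ∀ {v w} → EΓ.Adj v w → element R v * element R w ≈ 0#
    EΓ-adj⇒*≈0 (_ , _ , v≈v′ , w≈w′ , e) =
      trans (*-cong (element-cong v≈v′) (element-cong w≈w′)) (edge e)
      where
      edge : ∀ {v w} → Sum.Pointwise (Graph.Adj (Γ R ∇ Z R)) (Graph.Adj (U R ∇ Z-L R)) v w →
             element R v * element R w ≈ 0#
      edge (Sum.inj₁ (left p)) = p
      edge (Sum.inj₁ (cross {y = _ , y≈0})) = trans (*-congˡ y≈0) (zeroʳ _)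
      edge (Sum.inj₁ (cross′ {x = _ , x≈0})) = trans (*-congʳ x≈0) (zeroˡ _)
      edge (Sum.inj₂ (right {y = _ , y≈0} _)) = trans (*-congˡ y≈0) (zeroʳ _)
      edge (Sum.inj₂ (cross {y = _ , y≈0})) = trans (*-congˡ y≈0) (zeroʳ _)
      edge (Sum.inj₂ (cross′ {x = _ , x≈0})) = trans (*-congʳ x≈0) (zeroˡ _)

    -- The zero vertex has a copy in each part of EΓ R, and which copy carries the
    -- edge to v depends on the part that v lies in.
    EΓ-adj-zero : ∀ v w → element R w ≈ 0# → EΓ.Adj v w
    EΓ-adj-zero v@(inj₁ (inj₁ _)) w w≈0 =
      v , 0ˡ , element-injective v v refl , element-injective w 0ˡ w≈0 , Sum.inj₁ cross
      where 0ˡ = inj₁ (inj₂ (0# , refl))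
    -- Here `v` is 0 too, and `Z` has no loop, so both endpoints move to the copy in `Z-L`, whose
    -- loop is the edge.
    EΓ-adj-zero v@(inj₁ (inj₂ (_ , v≈0))) w w≈0 =
      0ʳ , 0ʳ , element-injective v 0ʳ v≈0 , element-injective w 0ʳ w≈0 , Sum.inj₂ (right tt)
      where 0ʳ = inj₂ (inj₂ (0# , refl))
    EΓ-adj-zero v@(inj₂ (inj₁ _)) w w≈0 =
      v , 0ʳ , element-injective v v refl , element-injective w 0ʳ w≈0 , Sum.inj₂ cross
      where 0ʳ = inj₂ (inj₂ (0# , refl))
    EΓ-adj-zero v@(inj₂ (inj₂ _)) w w≈0 =
      v , 0ʳ , element-injective v v refl , element-injective w 0ʳ w≈0 , Sum.inj₂ (right tt)
      where 0ʳ = inj₂ (inj₂ (0# , refl))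

    -- A unit factor cancels and forces the other factor to be 0, so every case except two vertices
    -- of `Γ` comes down to an edge at zero.
    *≈0⇒EΓ-adj : ∀ v w → element R v * element R w ≈ 0# → EΓ.Adj v w
    *≈0⇒EΓ-adj v@(inj₁ (inj₁ _)) w@(inj₁ (inj₁ _)) p =
      v , w , left (Sum.inj₁ refl) , left (Sum.inj₁ refl) , Sum.inj₁ (left p)
    *≈0⇒EΓ-adj v@(inj₂ (inj₁ (_ , uv))) w p = EΓ-adj-zero v w (unit-cancel uv p)
    *≈0⇒EΓ-adj v w@(inj₂ (inj₁ (_ , uw))) p =
      EΓ.Adj-sym {w} {v} (EΓ-adj-zero w v (unit-cancel uw (trans (*-comm _ _) p)))
    *≈0⇒EΓ-adj v@(inj₁ (inj₂ (_ , v≈0))) w p = EΓ.Adj-sym {w} {v} (EΓ-adj-zero w v v≈0)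
    *≈0⇒EΓ-adj v@(inj₂ (inj₂ (_ , v≈0))) w p = EΓ.Adj-sym {w} {v} (EΓ-adj-zero w v v≈0)
    *≈0⇒EΓ-adj v w@(inj₁ (inj₂ (_ , w≈0))) p = EΓ-adj-zero v w w≈0
    *≈0⇒EΓ-adj v w@(inj₂ (inj₂ (_ , w≈0))) p = EΓ-adj-zero v w w≈0

-- Transport along the ring isomorphism.

mainTheorem1 : {c ℓ c′ ℓ′ : Level} (R : CommutativeRing c ℓ) →
    (r : ℕ) → r ≥ 1 → (Rs : Fin r → CommutativeRing c′ ℓ′) →
    IsFinite R → IsNontrivial R →
    (∀ i → IsFinite (Rs i)) → (∀ i → IsNontrivial (Rs i)) →
    (∀ i → IsLocal (Rs i)) →
    R ≅ᴿ ∏ᴿ Rs →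
    Γ R ≅ᴳ ∏Γ Rs
mainTheorem1 R r _ Rs finR _ finRs 1≉0 _ (φ , φ-iso) = record
  { bijection = record
    { to        = to
    ; from      = from
    ; to-cong   = λ {x} {y} p → to-cong x y p
    -- The preimages `ψ v` and `ψ w` come from surjectivity separately, so they are compared through
    -- their images under `φ`.
    ; from-cong = λ {v} {w} p → φ-injective
        (P.trans (φ-ψ v) (P.trans (λ i → element-cong (Rs i) (p i)) (P.sym (φ-ψ w))))
    -- `vertex` always picks the copy of 0 in `Z`, so a round trip may move a coordinate of `v` to
    -- the other copy; `element-inj` absorbs this.
    ; inverse   = (λ {v} {x} p i → S.element-inj i _ _
                    (S.trans i (element-vertex i _)
                      (S.trans i (⟦⟧-cong p i) (φ-ψ v i))))
                , (λ {x} {v} p → φ-injective (P.trans (φ-ψ v) λ i →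
                    S.trans i (element-cong (Rs i) (p i))
                      (element-vertex i _)))
    }
  ; adjacency = λ x y → mk⇔
      (λ xy≈0 i → *≈0⇒EΓ-adj (Rs i) (1≉0 i) _ _
        (S.trans i (S.*-cong i (element-vertex i _) (element-vertex i _))
          (φ-annihilates xy≈0 i)))
      (λ adj → φ-injective (P.trans (*-homo _ _) (P.trans (λ i →
        S.trans i
          (S.sym i (S.*-cong i (element-vertex i _) (element-vertex i _)))
          (EΓ-adj⇒*≈0 (Rs i) (1≉0 i) (adj i)))
        (P.sym 0#-homo))))
  }
  where
  module R = CommutativeRing R
  module P = CommutativeRing (∏ᴿ Rs)
  module S (i : Fin r) where
    open CommutativeRing (Rs i) public
    element-inj = element-injective (Rs i) (1≉0 i)
  open RingMorphisms.IsRingIsomorphism φ-iso using (surjective; *-homo; 0#-homo; 1#-homo; ⟦⟧-cong)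
    renaming (injective to φ-injective)

  vertex : ∀ i → S.Carrier i → Graph.V (EΓ (Rs i))
  vertex i x = proj₁ (vertexOver (Rs i) (finRs i) x)

  element-vertex : ∀ i x → S._≈_ i (element (Rs i) (vertex i x)) x
  element-vertex i x = S.reflexive i (proj₂ (vertexOver (Rs i) (finRs i) x))

  φ-annihilates : ∀ {x y} → x R.* y R.≈ R.0# → φ x P.* φ y P.≈ P.0#
  φ-annihilates xy≈0 = P.trans (P.sym (*-homo _ _)) (P.trans (⟦⟧-cong xy≈0) 0#-homo)

  φ-unit : ∀ {x} → IsUnit R x → ∀ i → IsUnit (Rs i) (φ x i)
  φ-unit {x} (y , yx≈1 , xy≈1) i =
      φ y i
    , P.trans (P.sym (*-homo y x)) (P.trans (⟦⟧-cong yx≈1) 1#-homo) i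
    , P.trans (P.sym (*-homo x y)) (P.trans (⟦⟧-cong xy≈1) 1#-homo) i

  to : Graph.V (Γ R) → Graph.V (∏Γ Rs)
  to (x , x≉0 , y , y≉0 , xy≈0) = (λ i → vertex i (φ x i)) , [ notZero , notUnit ]
    where
    notZero : ¬ (∀ i → IsZero (Rs i) (element (Rs i) (vertex i (φ x i))))
    notZero z = x≉0 (φ-injective (P.trans
      (λ i → S.trans i (S.sym i (element-vertex i _)) (z i)) (P.sym 0#-homo)))

    notUnit : ¬ (∀ i → IsUnit (Rs i) (element (Rs i) (vertex i (φ x i))))
    -- If all components of `φ x` were units, cancelling them in `φ x * φ y ≈ 0` would kill every
    -- component of `φ y`, and hence the annihilator `y`.
    notUnit u = y≉0 (φ-injective (P.trans
      (λ i → unit-cancel (Rs i) (unit-resp (Rs i) (element-vertex i _) (u i))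
               (φ-annihilates xy≈0 i))
      (P.sym 0#-homo)))

  elements : Graph.V (∏Γ Rs) → P.Carrier
  elements v i = element (Rs i) (proj₁ v i)

  ψ : Graph.V (∏Γ Rs) → R.Carrier
  ψ v = proj₁ (surjective (elements v))

  φ-ψ : ∀ v → φ (ψ v) P.≈ elements v
  φ-ψ v = proj₂ (surjective (elements v)) R.refl

  -- If `ψ v` were zero or a unit, so would be every coordinate of its image under `φ`, and `v`
  -- would have been deleted. In the finite ring `R` only a nonzero zero-divisor remains.
  from : Graph.V (∏Γ Rs) → Graph.V (Γ R)
  from v@(_ , kept) = ψ v , ¬0-¬unit⇒zeroDivisor R finR
    (λ ψ≈0 → kept (inj₁ (P.trans (P.sym (φ-ψ v)) (P.trans (⟦⟧-cong ψ≈0) 0#-homo))))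
    (λ uψ → kept (inj₂ (λ i → unit-resp (Rs i) (φ-ψ v i) (φ-unit uψ i))))

  to-cong : ∀ x y → proj₁ x R.≈ proj₁ y → ∀ i →
            Graph._≈_ (EΓ (Rs i)) (proj₁ (to x) i) (proj₁ (to y) i)
  to-cong (x , _) (y , _) x≈y i = S.element-inj i _ _
    (S.trans i (element-vertex i _)
      (S.trans i (⟦⟧-cong x≈y i) (S.sym i (element-vertex i _))))
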